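{- For every integer $k\geq 4$, $$f(2k-1,k-1,k)=k^2-1.$$ The extremal graphs, i.e. the $k$-connected graphs of order $2k-1$ and independence number $k-1$ having exactly $f(2k-1,k-1,k)$ edges, are precisely (up to isomorphism) the graphs $\overline{K}_{k-1}\vee T$, where $T$ is a tree of order $k$. In particular, the following assertion (the Bougard--Joret conjecture) is false: for all integers $n,\alpha,k$ with $n\geq 2\alpha$, $n\geq\alpha+k$, $\alpha\geq 2$, $k\geq 3$, $$f(n,\alpha,k)=\begin{cases}\left\lceil \dfrac{nk}{2}\right\rceil,&n\leq k\alpha,\\[6pt] t(n,\alpha)+\left\lceil\dfrac{k\alpha}{2}\right\rceil,&n>k\alpha.\end{cases}$$
   Context: All graphs are finite, simple, and undirected. A graph is $k$-connected if it has more than $k$ vertices and deleting any set of fewer than $k$ vertices leaves a connected graph. The independence number of a graph is the maximum cardinality of a set of pairwise nonadjacent vertices. For integers $n,\alpha,k$ for which the class of $k$-connected graphs of order $n$ and independence number (exactly) $\alpha$ is nonempty, $f(n,\alpha,k)$ denotes the minimum number of edges of a graph in this class. $\overline{K}_s$ is the edgeless graph of order $s$. The join $G\vee H$ is obtained from disjoint copies of $G$ and $H$ by adding every edge with one endpoint in each copy. If $n=q\alpha+r$ with $0\leq r<\alpha$, then $t(n,\alpha)=r\binom{q+1}{2}+(\alpha-r)\binom{q}{2}$, the number of edges of the disjoint union of $\alpha$ cliques of total order $n$ whose orders differ by at most one. -}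

module Defs where

open import Data.Bool.Base using (Bool; true; false; T; _∧_; if_then_else_)
open import Data.Fin.Base using (Fin; zero; suc; inject₁; fromℕ; splitAt)
open import Data.Fin.Properties using (_<?_)
open import Data.Fin.Subset using (Subset; _∈_; ⊤; ∁; ∣_∣)
open import Data.Nat.Base
  using (ℕ; zero; suc; _+_; _*_; _∸_; _≤_; _<_; _>_; _≥_; _/_; _%_; ⌈_/2⌉; NonZero)
open import Data.Nat.Combinatorics using (_C_)
open import Data.Nat.Properties using (+-0-commutativeMonoid)
open import Algebra.Properties.CommutativeMonoid.Sum +-0-commutativeMonoid using (sum-syntax)
open import Data.Product.Base using (_×_; ∃-syntax; Σ-syntax)
open import Data.Sum.Base using (_⊎_; inj₁; inj₂)
open import Function.Bundles using (_↔_; module Inverse)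
open import Function.Definitions using (Injective)
open import Relation.Binary.Construct.Closure.ReflexiveTransitive using (Star)
open import Relation.Binary.PropositionalEquality.Core using (_≡_; refl)
open import Relation.Nullary using (¬_)
open import Relation.Nullary.Decidable.Core using (does)

record Graph (n : ℕ) : Set where
  field
    adj    : Fin n → Fin n → Bool
    sym    : ∀ u v → adj u v ≡ adj v u
    irrefl : ∀ u → adj u u ≡ false

  infix 4 _~_
  _~_ : Fin n → Fin n → Set
  u ~ v = T (adj u v)

open Graph public using (adj)

-- Each edge is counted once, at its pair of endpoints u < v.
size : ∀ {n} → Graph n → ℕ
size {n} G = ∑[ u < n ] ∑[ v < n ] (if does (u <? v) ∧ adj G u v then 1 else 0)

-- Isomorphic graphs need not have syntactically equal orders.
infix 4 _≅_
_≅_ : ∀ {m n} → Graph m → Graph n → Set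
_≅_ {m} {n} G H =
  Σ[ φ ∈ Fin m ↔ Fin n ]
    (∀ u v → adj H (Inverse.to φ u) (Inverse.to φ v) ≡ adj G u v)

-- The subgraph induced by S is connected.  The empty graph counts as connected;
-- this never matters for KConnected, where fewer than n vertices are deleted.
ConnectedOn : ∀ {n} → Graph n → Subset n → Set
ConnectedOn G S =
  ∀ u v → u ∈ S → v ∈ S → Star (λ x y → x ∈ S × y ∈ S × x ~ y) u v
  where open Graph G

Connected : ∀ {n} → Graph n → Set
Connected G = ConnectedOn G ⊤

KConnected : ∀ {n} → ℕ → Graph n → Set
KConnected {n} k G = n > k × (∀ (S : Subset n) → ∣ S ∣ < k → ConnectedOn G (∁ S))

Independent : ∀ {n} → Graph n → Subset n → Set
Independent G S = ∀ u v → u ∈ S → v ∈ S → ¬ u ~ v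
  where open Graph G

IndependenceNumber : ∀ {n} → Graph n → ℕ → Set
IndependenceNumber {n} G α =
  (∃[ S ] Independent G S × ∣ S ∣ ≡ α) ×
  (∀ (S : Subset n) → Independent G S → ∣ S ∣ ≤ α)

-- A cycle of length ℓ + 3.
record Cycle {n} (G : Graph n) : Set where
  open Graph G using (_~_)
  field
    ℓ         : ℕ
    vertex    : Fin (3 + ℓ) → Fin n
    injective : Injective _≡_ _≡_ vertex
    step      : ∀ i → vertex (inject₁ i) ~ vertex (suc i)
    close     : vertex (fromℕ (2 + ℓ)) ~ vertex zero

-- Only used for graphs of positive order, so nonemptiness is not required here.
IsTree : ∀ {n} → Graph n → Set
IsTree G = Connected G × ¬ Cycle G

K̄ : ∀ s → Graph s
K̄ s = record
  { adj    = λ _ _ → false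
  ; sym    = λ _ _ → refl
  ; irrefl = λ _ → refl
  }

infixr 5 _∨_
_∨_ : ∀ {m n} → Graph m → Graph n → Graph (m + n)
_∨_ {m} {n} G H = record
  { adj    = λ u v → adj⊎ (splitAt m u) (splitAt m v)
  ; sym    = λ u v → sym⊎ (splitAt m u) (splitAt m v)
  ; irrefl = λ u → irrefl⊎ (splitAt m u)
  }
  where
  adj⊎ : Fin m ⊎ Fin n → Fin m ⊎ Fin n → Bool
  adj⊎ (inj₁ u) (inj₁ v) = adj G u v
  adj⊎ (inj₁ _) (inj₂ _) = true
  adj⊎ (inj₂ _) (inj₁ _) = true
  adj⊎ (inj₂ u) (inj₂ v) = adj H u v

  sym⊎ : ∀ x y → adj⊎ x y ≡ adj⊎ y x
  sym⊎ (inj₁ u) (inj₁ v) = Graph.sym G u v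
  sym⊎ (inj₁ _) (inj₂ _) = refl
  sym⊎ (inj₂ _) (inj₁ _) = refl
  sym⊎ (inj₂ u) (inj₂ v) = Graph.sym H u v

  irrefl⊎ : ∀ x → adj⊎ x x ≡ false
  irrefl⊎ (inj₁ u) = Graph.irrefl G u
  irrefl⊎ (inj₂ v) = Graph.irrefl H v

InClass : ∀ n → ℕ → ℕ → Graph n → Set
InClass n α k G = KConnected k G × IndependenceNumber G α

-- "f(n,α,k) = m": since f is only defined when the class is nonempty, it is
-- given by its graph; the equation includes the assertion that f is defined.
f⟨_,_,_⟩≡_ : ℕ → ℕ → ℕ → ℕ → Set
f⟨ n , α , k ⟩≡ m =
  (∃[ G ] InClass n α k G × size G ≡ m) ×
  (∀ G → InClass n α k G → m ≤ size G)

Extremal : ∀ n → ℕ → ℕ → Graph n → Set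
Extremal n α k G = InClass n α k G × f⟨ n , α , k ⟩≡ size G

t : ∀ n α → .{{NonZero α}} → ℕ
t n α = r * ((q + 1) C 2) + (α ∸ r) * (q C 2)
  where
  q = n / α
  r = n % α

-- The instance argument is implied by α ≥ 2; it only serves to form t n α.
BougardJoretConjecture : Set
BougardJoretConjecture =
  ∀ n α k → .{{_ : NonZero α}} →
  n ≥ 2 * α → n ≥ α + k → α ≥ 2 → k ≥ 3 →
  (n ≤ k * α → f⟨ n , α , k ⟩≡ ⌈ n * k /2⌉) ×
  (n > k * α → f⟨ n , α , k ⟩≡ (t n α + ⌈ k * α /2⌉))

{-# OPTIONS --safe #-}
module Submission where

-- Write k = m + 1 and let S be an independent set of size m in a graph of the
-- class, so that k vertices lie outside S.  Deleting all of these but one is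
-- allowed, which forces every vertex of S to be adjacent to every vertex outside
-- S; deleting S shows that the subgraph H induced outside S is connected.  Hence
-- the graph is K̄ m ∨ H, with m k + size H ≥ m k + m = k² - 1 edges, and equality
-- holds iff H is a tree.  For k = 4 this gives f(7,3,4) = 15, where the
-- Bougard–Joret formula predicts 14.

open import Defs
open import Data.Bool.Base using (Bool; true; false; T; if_then_else_; _∧_)
open import Data.Bool.Properties using (T?)
open import Data.Empty using (⊥-elim)
open import Data.Fin.Base as Fin
  using (Fin; zero; suc; inject₁; fromℕ; toℕ; splitAt; join; _↑ˡ_; _↑ʳ_)
open import Data.Fin.Permutation using (↔⇒≡)
open import Data.Fin.Properties
  using (_≟_; _<?_; <-cmp; any?; splitAt-↑ˡ; splitAt-↑ʳ; join-splitAt;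
         suc-injective; toℕ-inject₁; +↔⊎)
open import Data.Fin.Relation.Unary.Top using (view; ‵fromℕ; ‵inject₁)
open import Data.Fin.Subset using (Subset; _∈_; _∉_; ⊤; ⊥; ∁; ∣_∣; _-_)
open import Data.Fin.Subset.Properties
  using (_∈?_; ∈⊤; ∉⊥; ∣⊤∣≡n; ∣⊥∣≡0; ∣p∣≤n; ∣∁p∣≡n∸∣p∣; ∣p∣≡n⇒p≡⊤; x∈p⇒x∉∁p; x∈∁p⇒x∉p;
         x∉p⇒x∈∁p; x∈p⇒∣p-x∣<∣p∣; x∈p∧x≢y⇒x∈p-y; Empty-unique; nonempty?; p─q⊆p)
open import Data.Nat.Base
  using (ℕ; zero; suc; _+_; _*_; _∸_; _^_; _≤_; _<_; _≥_; z≤n; s≤s; s≤s⁻¹)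
open import Data.Nat.Properties as ℕ
  using (+-0-commutativeMonoid; ≤-refl; ≤-trans; ≤-reflexive; ≤-antisym; +-identityʳ;
         +-mono-≤; +-assoc)
open import Data.Nat.Tactic.RingSolver using (solve-∀)
open import Data.Product.Base using (_×_; _,_; ∃; ∃-syntax; proj₁; proj₂)
open import Data.Sum.Base as Sum using (_⊎_; inj₁; inj₂; [_,_]′)
open import Data.Vec.Base as Vec using ([]; _∷_; here; there; _++_; lookup; tabulate)
open import Data.Vec.Properties
  using (lookup∘tabulate; lookup-++ˡ; lookup-++ʳ; []=⇒lookup; lookup⇒[]=)
open import Function.Base using (_∘_)
open import Function.Bundles using (_⇔_; _↔_; mk⇔; mk↔ₛ′; module Inverse)
open import Function.Construct.Composition using (_↔-∘_)
open import Function.Construct.Symmetry using (↔-sym)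
open import Function.Definitions using (Injective)
open import Level using (0ℓ)
open import Relation.Binary.Core using (Rel)
open import Relation.Binary.Construct.Closure.ReflexiveTransitive
  using (Star; ε; _◅_; _◅◅_; gmap; reverse)
open import Relation.Binary.Definitions using (tri<; tri≈; tri>)
open import Relation.Binary.PropositionalEquality
  using (_≡_; _≢_; refl; sym; trans; cong; cong₂; subst; subst₂; module ≡-Reasoning)
open import Relation.Nullary using (¬_; Dec; yes; no; contradiction)
open import Relation.Nullary.Decidable using (does; map′; _×-dec_)
open import Relation.Unary using (Decidable)
open import Algebra.Properties.CommutativeMonoid.Sum +-0-commutativeMonoid
  using (sum-syntax; sum-cong-≗; ∑-comm; ∑-distrib-+; ∑-permute; sum-replicate-zero)

-- Double counting

-- Edges are counted through the degree sum, which is twice `size`: `size` refers to the order of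
-- the vertices, which an isomorphism need not respect, while the degree sum is a full double sum
-- that can be reindexed and cut into blocks. The other obstacle is the tree criterion. Induction on
-- leaves would change the vertex set at every step. Instead one rooted spanning tree is fixed, and
-- for a connected graph of order n + 1 both having n edges and having no cycle are shown to mean
-- that every edge joins a child to its parent.

indicator : Bool → ℕ
indicator b = if b then 1 else 0

T⇒≡true : ∀ {b} → T b → b ≡ true
T⇒≡true {true} _ = refl

¬T⇒≡false : ∀ {b} → ¬ T b → b ≡ false
¬T⇒≡false {false} _  = refl
¬T⇒≡false {true}  ¬t = ⊥-elim (¬t _)

∑-const : ∀ n c → ∑[ i < n ] c ≡ n * c
∑-const zero    c = refl
∑-const (suc n) c = cong (c +_) (∑-const n c)

∑-mono-≤ : ∀ {n} {f g : Fin n → ℕ} → (∀ i → f i ≤ g i) → ∑[ i < n ] f i ≤ ∑[ i < n ] g i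
∑-mono-≤ {zero}  f≤g = z≤n
∑-mono-≤ {suc n} f≤g = +-mono-≤ (f≤g zero) (∑-mono-≤ (f≤g ∘ suc))

+-mono-≤-tight : ∀ {a b c d} → a ≤ b → c ≤ d → a + c ≡ b + d → a ≡ b × c ≡ d
+-mono-≤-tight {a} {b} {c} {d} a≤b c≤d eq =
  a≡b , ℕ.+-cancelˡ-≡ a c d (trans eq (cong (_+ d) (sym a≡b)))
  where
  b≤a : b ≤ a
  b≤a = ℕ.+-cancelʳ-≤ d b a (≤-trans (≤-reflexive (sym eq)) (ℕ.+-monoʳ-≤ a c≤d))
  a≡b : a ≡ b
  a≡b = ≤-antisym a≤b b≤a

-- Equal totals leave no slack in any term. Applied twice, this turns an equality of edge counts
-- into a statement about each single edge.
∑-mono-≤-tight : ∀ {n} {f g : Fin n → ℕ} → (∀ i → f i ≤ g i) →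
  ∑[ i < n ] f i ≡ ∑[ i < n ] g i → ∀ i → f i ≡ g i
∑-mono-≤-tight f≤g eq zero =
  proj₁ (+-mono-≤-tight (f≤g zero) (∑-mono-≤ (f≤g ∘ suc)) eq)
∑-mono-≤-tight f≤g eq (suc i) =
  ∑-mono-≤-tight (f≤g ∘ suc) (proj₂ (+-mono-≤-tight (f≤g zero) (∑-mono-≤ (f≤g ∘ suc)) eq)) i

∑-splitAt : ∀ m {n} (f : Fin (m + n) → ℕ) →
  ∑[ u < m + n ] f u ≡ ∑[ i < m ] f (i ↑ˡ n) + ∑[ j < n ] f (m ↑ʳ j)
∑-splitAt zero    f = refl
∑-splitAt (suc m) f = trans (cong (f zero +_) (∑-splitAt m (f ∘ suc))) (sym (+-assoc (f zero) _ _))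

∑-indicator-≟ : ∀ {n} (w : Fin n) → ∑[ v < n ] indicator (does (v ≟ w)) ≡ 1
∑-indicator-≟ {suc n} zero    = cong suc (sum-replicate-zero n)
∑-indicator-≟ {suc n} (suc w) = ∑-indicator-≟ w

module _ {n} (G : Graph n) where
  open Graph G using (_~_)

  ~-sym : ∀ {u v} → u ~ v → v ~ u
  ~-sym {u} {v} = subst T (Graph.sym G u v)

  ~-irrefl : ∀ {u} → ¬ u ~ u
  ~-irrefl {u} = subst T (Graph.irrefl G u)

degreeSum : ∀ {n} → Graph n → ℕ
degreeSum {n} G = ∑[ u < n ] ∑[ v < n ] indicator (adj G u v)

-- The handshake lemma: the adjacency matrix vanishes on the diagonal, and exchanging the two sums
-- carries its lower triangle to its upper one.
degreeSum≡size+size : ∀ {n} (G : Graph n) → degreeSum G ≡ size G + size G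
degreeSum≡size+size {n} G = begin
  degreeSum G
    ≡⟨ sum-cong-≗ (λ u → sum-cong-≗ (split u)) ⟩
  ∑[ u < n ] ∑[ v < n ] (below u v + below v u)
    ≡⟨ sum-cong-≗ (λ u → ∑-distrib-+ (below u) (λ v → below v u)) ⟩
  ∑[ u < n ] (∑[ v < n ] below u v + ∑[ v < n ] below v u)
    ≡⟨ ∑-distrib-+ (λ u → ∑[ v < n ] below u v) (λ u → ∑[ v < n ] below v u) ⟩
  size G + ∑[ u < n ] ∑[ v < n ] below v u
    ≡⟨ cong (size G +_) (∑-comm (λ u v → below v u)) ⟩
  size G + size G ∎
  where
  open ≡-Reasoning
  below : Fin n → Fin n → ℕ
  below u v = indicator (does (u <? v) ∧ adj G u v)
  -- The two decisions are arguments, so that matching on them reduces both occurrences of `does`.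
  splitDec : ∀ u v (u<v? : Dec (u Fin.< v)) (v<u? : Dec (v Fin.< u)) →
    indicator (adj G u v) ≡
    indicator (does u<v? ∧ adj G u v) + indicator (does v<u? ∧ adj G v u)
  splitDec u v (yes u<v) (yes v<u) = contradiction v<u (ℕ.<⇒≯ u<v)
  splitDec u v (yes _)   (no _)    = sym (+-identityʳ _)
  splitDec u v (no _)    (yes _)   = cong indicator (Graph.sym G u v)
  splitDec u v (no u≮v)  (no v≮u) with <-cmp u v
  ... | tri< u<v _ _  = contradiction u<v u≮v
  ... | tri> _ _ v<u  = contradiction v<u v≮u
  ... | tri≈ _ refl _ = cong indicator (Graph.irrefl G u)
  split : ∀ u v → indicator (adj G u v) ≡ below u v + below v u
  split u v = splitDec u v (u <? v) (v <? u)

+-diag-injective : ∀ {a b} → a + a ≡ b + b → a ≡ b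
+-diag-injective {a} {b} eq with ℕ.<-cmp a b
... | tri< a<b _ _ = contradiction eq (ℕ.<⇒≢ (ℕ.+-mono-< a<b a<b))
... | tri≈ _ a≡b _ = a≡b
... | tri> _ _ b<a = contradiction (sym eq) (ℕ.<⇒≢ (ℕ.+-mono-< b<a b<a))

+-diag-cancel-≤ : ∀ {a b} → a + a ≤ b + b → a ≤ b
+-diag-cancel-≤ {a} {b} le with ℕ.≤-<-connex a b
... | inj₁ a≤b = a≤b
... | inj₂ b<a = contradiction le (ℕ.<⇒≱ (ℕ.+-mono-< b<a b<a))

size-≅ : ∀ {m n} {G : Graph m} {H : Graph n} → G ≅ H → size G ≡ size H
size-≅ {m} {n} {G} {H} (φ , preserves) = +-diag-injective (begin
  size G + size G ≡⟨ degreeSum≡size+size G ⟨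
  degreeSum G
    ≡⟨ sum-cong-≗ (λ u → sum-cong-≗ (λ v → cong indicator (preserves u v))) ⟨
  ∑[ u < m ] ∑[ v < m ] indicator (adj H (to u) (to v))
    ≡⟨ sum-cong-≗ (λ u → ∑-permute (λ v → indicator (adj H (to u) v)) φ) ⟨
  ∑[ u < m ] ∑[ v < n ] indicator (adj H (to u) v)
    ≡⟨ ∑-permute (λ u → ∑[ v < n ] indicator (adj H u v)) φ ⟨
  degreeSum H     ≡⟨ degreeSum≡size+size H ⟩
  size H + size H ∎)
  where
  open ≡-Reasoning
  open Inverse φ using (to)

-- Joins

module _ {m n} (G : Graph m) (H : Graph n) where

  ∨-adj-ll : ∀ i j → adj (G ∨ H) (i ↑ˡ n) (j ↑ˡ n) ≡ adj G i j
  ∨-adj-ll i j rewrite splitAt-↑ˡ m i n | splitAt-↑ˡ m j n = refl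

  ∨-adj-lr : ∀ i j → adj (G ∨ H) (i ↑ˡ n) (m ↑ʳ j) ≡ true
  ∨-adj-lr i j rewrite splitAt-↑ˡ m i n | splitAt-↑ʳ m n j = refl

  ∨-adj-rl : ∀ i j → adj (G ∨ H) (m ↑ʳ i) (j ↑ˡ n) ≡ true
  ∨-adj-rl i j rewrite splitAt-↑ˡ m j n | splitAt-↑ʳ m n i = refl

  ∨-adj-rr : ∀ i j → adj (G ∨ H) (m ↑ʳ i) (m ↑ʳ j) ≡ adj H i j
  ∨-adj-rr i j rewrite splitAt-↑ʳ m n i | splitAt-↑ʳ m n j = refl

  -- The adjacency matrix of the join has four blocks: those of `G` and `H` on the diagonal, and two
  -- filled with ones.
  degreeSum-∨ : degreeSum (G ∨ H) ≡ (degreeSum G + m * n) + (n * m + degreeSum H)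
  degreeSum-∨ = trans (∑-splitAt m _) (cong₂ _+_ fromLeft fromRight)
    where
    open ≡-Reasoning
    row : Fin (m + n) → ℕ
    row u = ∑[ v < m + n ] indicator (adj (G ∨ H) u v)
    ∑-ones : ∀ {k} {f : Fin k → Bool} → (∀ i → f i ≡ true) → ∑[ i < k ] indicator (f i) ≡ k
    ∑-ones {k} f≡true = trans (sum-cong-≗ (λ i → cong indicator (f≡true i)))
                              (trans (∑-const k 1) (ℕ.*-identityʳ k))
    fromLeft : ∑[ i < m ] row (i ↑ˡ n) ≡ degreeSum G + m * n
    fromLeft = begin
      ∑[ i < m ] row (i ↑ˡ n)
        ≡⟨ sum-cong-≗ (λ i → trans (∑-splitAt m _)
             (cong₂ _+_ (sum-cong-≗ (λ j → cong indicator (∨-adj-ll i j))) (∑-ones (∨-adj-lr i)))) ⟩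
      ∑[ i < m ] (∑[ j < m ] indicator (adj G i j) + n)
        ≡⟨ ∑-distrib-+ (λ i → ∑[ j < m ] indicator (adj G i j)) (λ _ → n) ⟩
      degreeSum G + ∑[ i < m ] n
        ≡⟨ cong (degreeSum G +_) (∑-const m n) ⟩
      degreeSum G + m * n ∎
    fromRight : ∑[ j < n ] row (m ↑ʳ j) ≡ n * m + degreeSum H
    fromRight = begin
      ∑[ i < n ] row (m ↑ʳ i)
        ≡⟨ sum-cong-≗ (λ i → trans (∑-splitAt m _)
             (cong₂ _+_ (∑-ones (∨-adj-rl i)) (sum-cong-≗ (λ j → cong indicator (∨-adj-rr i j))))) ⟩
      ∑[ i < n ] (m + ∑[ j < n ] indicator (adj H i j))
        ≡⟨ ∑-distrib-+ (λ _ → m) (λ i → ∑[ j < n ] indicator (adj H i j)) ⟩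
      ∑[ i < n ] m + degreeSum H
        ≡⟨ cong (_+ degreeSum H) (∑-const n m) ⟩
      n * m + degreeSum H ∎

  size-∨ : size (G ∨ H) ≡ size G + m * n + size H
  size-∨ = +-diag-injective (begin
    size (G ∨ H) + size (G ∨ H) ≡⟨ degreeSum≡size+size (G ∨ H) ⟨
    degreeSum (G ∨ H)           ≡⟨ degreeSum-∨ ⟩
    (degreeSum G + m * n) + (n * m + degreeSum H)
      ≡⟨ cong₂ (λ x y → (x + m * n) + (n * m + y)) (degreeSum≡size+size G) (degreeSum≡size+size H) ⟩
    (size G + size G + m * n) + (n * m + (size H + size H))
      ≡⟨ regroup (size G) (size H) m n ⟩
    (size G + m * n + size H) + (size G + m * n + size H) ∎)
    where
    open ≡-Reasoning
    regroup : ∀ g h m n → (g + g + m * n) + (n * m + (h + h)) ≡ (g + m * n + h) + (g + m * n + h)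
    regroup = solve-∀

size-K̄ : ∀ s → size (K̄ s) ≡ 0
size-K̄ s = +-diag-injective (begin
  size (K̄ s) + size (K̄ s) ≡⟨ degreeSum≡size+size (K̄ s) ⟨
  degreeSum (K̄ s)         ≡⟨ sum-cong-≗ (λ (_ : Fin s) → sum-replicate-zero s) ⟩
  ∑[ u < s ] 0            ≡⟨ sum-replicate-zero s ⟩
  0 ∎)
  where open ≡-Reasoning

-- Spanning trees

least : {P : ℕ → Set} → Decidable P → ∀ n → P n → ∃[ m ] P m × (∀ {j} → P j → m ≤ j)
least P? zero p = zero , p , λ _ → z≤n
least P? (suc n) p with P? zero | least (P? ∘ suc) n p
... | yes p₀ | _               = zero , p₀ , λ _ → z≤n
... | no ¬p₀ | m , pₘ , minimal = suc m , pₘ ,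
  λ { {zero} q → contradiction q ¬p₀ ; {suc j} q → s≤s (minimal q) }

-- A spanning tree rooted at vertex zero; parent i is the parent of vertex suc i.
record SpanningTree {n} (G : Graph (suc n)) : Set where
  open Graph G using (_~_)
  field
    parent   : Fin n → Fin (suc n)
    parent-~ : ∀ i → suc i ~ parent i
    depth    : Fin (suc n) → ℕ
    depth-<  : ∀ i → depth (parent i) < depth (suc i)

-- Breadth-first search: depths are distances to the root.
spanningTree : ∀ {n} {G : Graph (suc n)} → Connected G → SpanningTree G
spanningTree {n} {G} connected = record
  { parent   = λ i → proj₁ (step i)
  ; parent-~ = λ i → proj₁ (proj₂ (step i))
  ; depth    = depth
  ; depth-<  = λ i → proj₂ (proj₂ (step i))
  }
  where
  open Graph G using (_~_)
  -- A walk of exactly the given length to the root. With the length fixed, existence is decidable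
  -- by finite search, so a least length can be found.
  Reach : Fin (suc n) → ℕ → Set
  Reach v zero    = v ≡ zero
  Reach v (suc ℓ) = ∃[ w ] v ~ w × Reach w ℓ
  reach? : ∀ v → Decidable (Reach v)
  reach? v zero    = v ≟ zero
  reach? v (suc ℓ) = any? (λ w → T? (adj G v w) ×-dec reach? w ℓ)
  fromWalk : ∀ {R : Rel (Fin (suc n)) 0ℓ} → (∀ {x y} → R x y → x ~ y) →
    ∀ {v} → Star R v zero → ∃ (Reach v)
  fromWalk R⊆~ ε          = zero , refl
  fromWalk R⊆~ (r ◅ walk) = let ℓ , reached = fromWalk R⊆~ walk in suc ℓ , _ , R⊆~ r , reached
  shortest : ∀ v → ∃[ m ] Reach v m × (∀ {j} → Reach v j → m ≤ j)
  shortest v =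
    let ℓ , reached = fromWalk (proj₂ ∘ proj₂) (connected v zero ∈⊤ ∈⊤)
    in least (reach? v) ℓ reached
  depth : Fin (suc n) → ℕ
  depth v = proj₁ (shortest v)
  step : ∀ i → ∃[ w ] suc i ~ w × depth w < depth (suc i)
  step i with shortest (suc i)
  -- Length zero is impossible, since `suc i` is not the root. The second vertex `w` of a shortest
  -- walk reaches the root in `ℓ` steps, so its own distance is at most `ℓ`.
  ... | suc ℓ , (w , i~w , reached) , _ = w , i~w , s≤s (proj₂ (proj₂ (shortest w)) reached)

-- Shaped like `Cycle`, so that a path with at least two steps becomes a cycle by adding the closing
-- edge.
record SimplePath {n} (R : Rel (Fin n) 0ℓ) (u v : Fin n) : Set where
  field
    ℓ         : ℕ
    vertex    : Fin (suc ℓ) → Fin n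
    injective : Injective _≡_ _≡_ vertex
    start     : vertex zero ≡ u
    end       : vertex (fromℕ ℓ) ≡ v
    step      : ∀ i → R (vertex (inject₁ i)) (vertex (suc i))

module _ {n} {R : Rel (Fin n) 0ℓ} where
  open SimplePath

  suffix : ∀ {u v} (path : SimplePath R u v) (i : Fin (suc (ℓ path))) →
    SimplePath R (vertex path i) v
  suffix path zero = record
    { ℓ = ℓ path ; vertex = vertex path ; injective = injective path
    ; start = refl ; end = end path ; step = step path }
  suffix record { ℓ = suc ℓ ; vertex = f ; injective = inj ; end = end ; step = step } (suc i) =
    suffix record
      { ℓ = ℓ ; vertex = f ∘ suc ; injective = suc-injective ∘ inj
      ; start = refl ; end = end ; step = step ∘ suc } i

  -- Loop erasure: if the new first vertex already occurs on the simple path built from the rest of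
  -- the walk, everything before that occurrence is cut off.
  simplePath : ∀ {u v} → Star R u v → SimplePath R u v
  simplePath {u} ε = record
    { ℓ = zero ; vertex = λ _ → u ; injective = λ { {zero} {zero} _ → refl }
    ; start = refl ; end = refl ; step = λ () }
  simplePath {u} {v} (r ◅ walk) with simplePath walk
  ... | path with any? (λ i → vertex path i ≟ u)
  ... | yes (i , eq) = subst (λ w → SimplePath R w v) eq (suffix path i)
  ... | no fresh = record
    { ℓ         = suc (ℓ path)
    ; vertex    = λ { zero → u ; (suc i) → vertex path i }
    ; injective = λ
        { {zero}  {zero}  _  → refl
        ; {zero}  {suc j} eq → contradiction (j , sym eq) fresh
        ; {suc i} {zero}  eq → contradiction (i , eq) fresh
        ; {suc i} {suc j} eq → cong suc (injective path eq) }
    ; start     = refl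
    ; end       = end path
    ; step      = λ { zero → subst (R u) (sym (start path)) r ; (suc i) → step path i }
    }

argmax : ∀ {n} (f : Fin (suc n) → ℕ) → ∃[ i ] (∀ j → f j ≤ f i)
argmax {zero}  f = zero , λ { zero → ≤-refl }
argmax {suc n} f with argmax (f ∘ suc)
... | i , max with ℕ.≤-total (f zero) (f (suc i))
... | inj₁ f₀≤ = suc i , λ { zero → f₀≤ ; (suc j) → max j }
... | inj₂ ≤f₀ = zero , λ { zero → ≤-refl ; (suc j) → ≤-trans (max j) ≤f₀ }

module _ {n} {G : Graph n} (C : Cycle G) where
  open Graph G using (_~_)
  open Cycle C

  -- The closing edge serves the last and the first position; every other position has a predecessor
  -- and a successor. Having at least three vertices keeps the two neighbours apart.
  cycle-neighbours : ∀ i → ∃[ a ] ∃[ b ] a ≢ b × vertex i ~ vertex a × vertex i ~ vertex b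
  cycle-neighbours i with view i
  ... | ‵fromℕ =
    inject₁ (fromℕ (suc ℓ)) , zero , (λ ()) , ~-sym G (step (fromℕ (suc ℓ))) , close
  ... | ‵inject₁ zero =
    fromℕ (2 + ℓ) , suc zero , (λ ()) , ~-sym G close , step zero
  ... | ‵inject₁ (suc j) =
    inject₁ (inject₁ j) , suc (suc j) , distinct , ~-sym G (step (inject₁ j)) , step (suc j)
    where
    distinct : inject₁ (inject₁ j) ≢ suc (suc j)
    distinct eq = ℕ.m≢1+n+m (toℕ j) {1} (begin
      toℕ j                     ≡⟨ toℕ-inject₁ j ⟨
      toℕ (inject₁ j)           ≡⟨ toℕ-inject₁ (inject₁ j) ⟨
      toℕ (inject₁ (inject₁ j)) ≡⟨ cong toℕ eq ⟩
      2 + toℕ j                 ∎)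
      where open ≡-Reasoning

-- Tree edges: edge counts and cycles relative to a rooted spanning tree

module _ {n} {G : Graph (suc n)} (tree : SpanningTree G) where
  open Graph G using (_~_)
  open SpanningTree tree

  data Child : Fin (suc n) → Fin (suc n) → Set where
    child : ∀ i → Child (suc i) (parent i)

  child? : ∀ u v → Dec (Child u v)
  child? zero    v = no λ ()
  child? (suc i) v = map′ (λ { refl → child i }) (λ { (child _) → refl }) (v ≟ parent i)

  TreeEdge : Rel (Fin (suc n)) 0ℓ
  TreeEdge u v = Child u v ⊎ Child v u

  child-depth-< : ∀ {u v} → Child u v → depth v < depth u
  child-depth-< (child i) = depth-< i

  child-functional : ∀ {u v w} → Child u v → Child u w → v ≡ w
  child-functional (child i) (child .i) = refl

  treeEdge⇒~ : ∀ {u v} → TreeEdge u v → u ~ v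
  treeEdge⇒~ (inj₁ (child i)) = parent-~ i
  treeEdge⇒~ (inj₂ (child i)) = ~-sym G (parent-~ i)

  treeWeight : Fin (suc n) → Fin (suc n) → ℕ
  treeWeight u v = indicator (does (child? u v)) + indicator (does (child? v u))

  ∑∑-child : ∑[ u < suc n ] ∑[ v < suc n ] indicator (does (child? u v)) ≡ n
  ∑∑-child = begin
    -- By computation of `child?`, the row of the root is zero and the row of `suc i` has its single
    -- one at `parent i`.
    ∑[ v < suc n ] 0 + ∑[ i < n ] ∑[ v < suc n ] indicator (does (v ≟ parent i))
      ≡⟨ cong₂ _+_ (sum-replicate-zero (suc n)) (sum-cong-≗ (∑-indicator-≟ ∘ parent)) ⟩
    ∑[ i < n ] 1 ≡⟨ ∑-const n 1 ⟩
    n * 1        ≡⟨ ℕ.*-identityʳ n ⟩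
    n            ∎
    where open ≡-Reasoning

  ∑∑-treeWeight : ∑[ u < suc n ] ∑[ v < suc n ] treeWeight u v ≡ n + n
  ∑∑-treeWeight = begin
    ∑[ u < suc n ] ∑[ v < suc n ] treeWeight u v
      ≡⟨ sum-cong-≗ (λ u → ∑-distrib-+ (λ v → up u v) (λ v → up v u)) ⟩
    ∑[ u < suc n ] (∑[ v < suc n ] up u v + ∑[ v < suc n ] up v u)
      ≡⟨ ∑-distrib-+ (λ u → ∑[ v < suc n ] up u v) (λ u → ∑[ v < suc n ] up v u) ⟩
    ∑[ u < suc n ] ∑[ v < suc n ] up u v + ∑[ u < suc n ] ∑[ v < suc n ] up v u
      ≡⟨ cong₂ _+_ ∑∑-child (trans (∑-comm (λ u v → up v u)) ∑∑-child) ⟩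
    n + n ∎
    where
    open ≡-Reasoning
    up : Fin (suc n) → Fin (suc n) → ℕ
    up u v = indicator (does (child? u v))

  -- Depth decreases from child to parent, so two vertices cannot be children of each other and the
  -- weight never reaches 2.
  treeWeight≤adj : ∀ u v → treeWeight u v ≤ indicator (adj G u v)
  treeWeight≤adj u v with child? u v | child? v u
  ... | yes c | yes c′ = contradiction (child-depth-< c) (ℕ.<⇒≯ (child-depth-< c′))
  ... | yes c | no _   = ≤-reflexive (sym (cong indicator (T⇒≡true (treeEdge⇒~ (inj₁ c)))))
  ... | no _  | yes c  = ≤-reflexive (sym (cong indicator (T⇒≡true (treeEdge⇒~ (inj₂ c)))))
  ... | no _  | no _   = z≤n

  n≤size : n ≤ size G
  n≤size = +-diag-cancel-≤ (begin
    n + n           ≡⟨ ∑∑-treeWeight ⟨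
    ∑[ u < suc n ] ∑[ v < suc n ] treeWeight u v
                    ≤⟨ ∑-mono-≤ (λ u → ∑-mono-≤ (treeWeight≤adj u)) ⟩
    degreeSum G     ≡⟨ degreeSum≡size+size G ⟩
    size G + size G ∎)
    where open ℕ.≤-Reasoning

  -- With n edges, the degree sum equals the total tree weight 2n. The weights lie below the
  -- adjacency matrix entry by entry, so they agree with it everywhere.
  size≡n⇒treeEdge : size G ≡ n → ∀ {u v} → u ~ v → TreeEdge u v
  size≡n⇒treeEdge size≡n {u} {v} u~v with tight
    where
    total : ∑[ u < suc n ] ∑[ v < suc n ] treeWeight u v ≡ degreeSum G
    total = trans ∑∑-treeWeight (trans (sym (cong₂ _+_ size≡n size≡n)) (sym (degreeSum≡size+size G)))
    tight : treeWeight u v ≡ 1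
    tight = trans
      (∑-mono-≤-tight (treeWeight≤adj u)
        (∑-mono-≤-tight (λ u → ∑-mono-≤ (treeWeight≤adj u)) total u) v)
      (cong indicator (T⇒≡true u~v))
  ... | tight with child? u v | child? v u
  ... | yes c | _     = inj₁ c
  ... | no _  | yes c = inj₂ c
  ... | no _  | no _  = contradiction tight λ ()

  treeEdge⇒size≡n : (∀ {u v} → u ~ v → TreeEdge u v) → size G ≡ n
  treeEdge⇒size≡n ~⇒treeEdge = +-diag-injective (begin
    size G + size G ≡⟨ degreeSum≡size+size G ⟨
    degreeSum G     ≡⟨ sum-cong-≗ (λ u → sum-cong-≗ (λ v → ≤-antisym (adj≤ u v) (treeWeight≤adj u v))) ⟩
    ∑[ u < suc n ] ∑[ v < suc n ] treeWeight u v ≡⟨ ∑∑-treeWeight ⟩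
    n + n           ∎)
    where
    open ≡-Reasoning
    adj≤ : ∀ u v → indicator (adj G u v) ≤ treeWeight u v
    adj≤ u v with T? (adj G u v)
    ... | no ¬u~v rewrite ¬T⇒≡false ¬u~v = z≤n
    ... | yes u~v rewrite T⇒≡true u~v with child? u v | child? v u | ~⇒treeEdge u~v
    ... | yes _ | _     | _      = s≤s z≤n
    ... | no _  | yes _ | _      = ≤-refl
    ... | no ¬c | no _  | inj₁ c = contradiction c ¬c
    ... | no _  | no ¬c | inj₂ c = contradiction c ¬c

  -- A deepest vertex of a cycle would have two distinct parents.
  treeEdge⇒acyclic : (∀ {u v} → u ~ v → TreeEdge u v) → ¬ Cycle G
  treeEdge⇒acyclic ~⇒treeEdge C with argmax (depth ∘ Cycle.vertex C)
  ... | i , deepest with cycle-neighbours C i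
  ... | a , b , a≢b , i~a , i~b =
    a≢b (injective (child-functional (isParent a i~a) (isParent b i~b)))
    where
    open Cycle C
    isParent : ∀ c → vertex i ~ vertex c → Child (vertex i) (vertex c)
    isParent c i~c with ~⇒treeEdge i~c
    ... | inj₁ up   = up
    ... | inj₂ down = contradiction (child-depth-< down) (ℕ.≤⇒≯ (deepest c))

  walkToRoot : ∀ u → Star TreeEdge u zero
  walkToRoot u = go (depth u) u ≤-refl
    where
    -- The bound `d` makes the recursion structural: it drops by one as the depth drops along
    -- `parent`.
    go : ∀ d u → depth u ≤ d → Star TreeEdge u zero
    go d       zero    _  = ε
    go zero    (suc i) le = contradiction (≤-trans (depth-< i) le) λ ()
    go (suc d) (suc i) le = inj₁ (child i) ◅ go d (parent i) (s≤s⁻¹ (≤-trans (depth-< i) le))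

  -- An edge outside the tree closes a tree path into a cycle.
  acyclic⇒treeEdge : ¬ Cycle G → ∀ {u v} → u ~ v → TreeEdge u v
  acyclic⇒treeEdge acyclic {u} {v} u~v with child? u v | child? v u
  ... | yes c | _     = inj₁ c
  ... | no _  | yes c = inj₂ c
  ... | no ¬c | no ¬c′ = contradiction (closeUp path) acyclic
    where
    path : SimplePath TreeEdge u v
    path = simplePath (walkToRoot u ◅◅ reverse Sum.swap (walkToRoot v))
    closeUp : SimplePath TreeEdge u v → Cycle G
    -- A path without steps would make `uv` a loop, and one with a single step would make `uv` a
    -- tree edge; in all other cases there are the three vertices that a cycle needs.
    closeUp record { ℓ = zero ; start = refl ; end = refl } = contradiction u~v (~-irrefl G)
    closeUp record { ℓ = suc zero ; start = refl ; end = refl ; step = step } =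
      contradiction (step zero) [ ¬c , ¬c′ ]′
    closeUp record { ℓ = suc (suc ℓ) ; vertex = f ; injective = inj ; start = refl ; end = refl ; step = step } =
      record { ℓ = ℓ ; vertex = f ; injective = inj ; step = treeEdge⇒~ ∘ step ; close = ~-sym G u~v }

module _ {n} {G : Graph (suc n)} (connected : Connected G) where
  private
    tree : SpanningTree G
    tree = spanningTree connected

  connected⇒size≥ : n ≤ size G
  connected⇒size≥ = n≤size tree

  acyclic⇒size≡ : ¬ Cycle G → size G ≡ n
  acyclic⇒size≡ acyclic = treeEdge⇒size≡n tree (acyclic⇒treeEdge tree acyclic)

  size≡⇒acyclic : size G ≡ n → ¬ Cycle G
  size≡⇒acyclic size≡n = treeEdge⇒acyclic tree (size≡n⇒treeEdge tree size≡n)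

-- Invariance under isomorphism

≅-sym : ∀ {m n} {G : Graph m} {H : Graph n} → G ≅ H → H ≅ G
≅-sym {G = G} {H} (φ , preserves) = ↔-sym φ , λ u v →
  trans (sym (preserves (from u) (from v)))
        (cong₂ (adj H) (strictlyInverseˡ u) (strictlyInverseˡ v))
  where open Inverse φ using (from; strictlyInverseˡ)

∣p∣≡∑ : ∀ {n} (p : Subset n) → ∣ p ∣ ≡ ∑[ i < n ] indicator (lookup p i)
∣p∣≡∑ []          = refl
∣p∣≡∑ (true ∷ p)  = cong suc (∣p∣≡∑ p)
∣p∣≡∑ (false ∷ p) = ∣p∣≡∑ p

module _ {m n} (φ : Fin m ↔ Fin n) (S : Subset m) where
  open Inverse φ using (to; from; strictlyInverseʳ)

  image : Subset n
  image = tabulate (lookup S ∘ from)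

  ∣image∣ : ∣ image ∣ ≡ ∣ S ∣
  ∣image∣ = begin
    ∣ image ∣ ≡⟨ ∣p∣≡∑ image ⟩
    ∑[ j < n ] indicator (lookup image j)
      ≡⟨ sum-cong-≗ (λ j → cong indicator (lookup∘tabulate (lookup S ∘ from) j)) ⟩
    ∑[ j < n ] indicator (lookup S (from j))
      ≡⟨ ∑-permute (λ i → indicator (lookup S i)) (↔-sym φ) ⟨
    ∑[ i < m ] indicator (lookup S i) ≡⟨ ∣p∣≡∑ S ⟨
    ∣ S ∣ ∎
    where open ≡-Reasoning

  ∈-image⁻ : ∀ {v} → v ∈ image → from v ∈ S
  ∈-image⁻ {v} v∈ =
    lookup⇒[]= (from v) S (trans (sym (lookup∘tabulate (lookup S ∘ from) v)) ([]=⇒lookup v∈))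

  ∈-image⁺ : ∀ {v} → from v ∈ S → v ∈ image
  ∈-image⁺ {v} ∈S =
    lookup⇒[]= v image (trans (lookup∘tabulate (lookup S ∘ from) v) ([]=⇒lookup ∈S))

  ∈-∁-image⁺ : ∀ {u} → u ∈ ∁ S → to u ∈ ∁ image
  ∈-∁-image⁺ {u} u∈∁S =
    x∉p⇒x∈∁p (x∈∁p⇒x∉p u∈∁S ∘ subst (_∈ S) (strictlyInverseʳ u) ∘ ∈-image⁻)

  ∈-∁-image⁻ : ∀ {v} → v ∈ ∁ image → from v ∈ ∁ S
  ∈-∁-image⁻ v∈ = x∉p⇒x∈∁p (x∈∁p⇒x∉p v∈ ∘ ∈-image⁺)

module _ {m n} {G : Graph m} {H : Graph n} (iso : G ≅ H) where
  private
    φ = proj₁ iso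
    open Inverse φ using (to; from; strictlyInverseʳ)

  Independent-image : ∀ {S} → Independent G S → Independent H (image φ S)
  Independent-image {S} indep u v u∈ v∈ u~v =
    indep (from u) (from v) (∈-image⁻ φ S u∈) (∈-image⁻ φ S v∈)
      (subst T (sym (proj₂ (≅-sym {G = G} {H} iso) u v)) u~v)

  ConnectedOn-∁-image : ∀ {S} → ConnectedOn H (∁ (image φ S)) → ConnectedOn G (∁ S)
  ConnectedOn-∁-image {S} connected u v u∈ v∈ =
    subst₂ (Star _) (strictlyInverseʳ u) (strictlyInverseʳ v)
      (gmap from
        (λ { {x} {y} (x∈ , y∈ , x~y) →
             ∈-∁-image⁻ φ S x∈ , ∈-∁-image⁻ φ S y∈ ,
             subst T (sym (proj₂ (≅-sym {G = G} {H} iso) x y)) x~y })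
        (connected (to u) (to v) (∈-∁-image⁺ φ S u∈) (∈-∁-image⁺ φ S v∈)))

  KConnected-≅ : ∀ {k} → KConnected k H → KConnected k G
  KConnected-≅ (n>k , connected) =
    subst (_ <_) (sym (↔⇒≡ φ)) n>k ,
    λ S ∣S∣<k → ConnectedOn-∁-image
      (connected (image φ S) (subst (_< _) (sym (∣image∣ φ S)) ∣S∣<k))

IndependenceNumber-≅ : ∀ {m n} {G : Graph m} {H : Graph n} → G ≅ H →
  ∀ {α} → IndependenceNumber H α → IndependenceNumber G α
IndependenceNumber-≅ {G = G} {H} iso@(φ , _) ((S , indep , ∣S∣≡α) , max) =
  (image (↔-sym φ) S ,
   Independent-image {G = H} {G} (≅-sym {G = G} {H} iso) indep ,
   trans (∣image∣ (↔-sym φ) S) ∣S∣≡α) ,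
  λ R indepR → subst (_≤ _) (∣image∣ φ R)
    (max (image φ R) (Independent-image {G = G} {H} iso indepR))

InClass-≅ : ∀ {m n α k} {G : Graph m} {H : Graph n} → G ≅ H → InClass n α k H → InClass m α k G
InClass-≅ {G = G} {H} iso (kconn , indep) =
  KConnected-≅ {G = G} {H} iso kconn , IndependenceNumber-≅ {G = G} {H} iso indep

-- Joins of edgeless and connected graphs

-- Matching on this view puts a vertex of a join into the form to which the `∨-adj` lemmas apply.
data SideView m n : Fin (m + n) → Set where
  left  : ∀ i → SideView m n (i ↑ˡ n)
  right : ∀ j → SideView m n (m ↑ʳ j)

sideView : ∀ m {n} u → SideView m n u
sideView m {n} u = subst (SideView m n) (join-splitAt m n u) (side (splitAt m u))
  where
  side : ∀ x → SideView m n (join m n x)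
  side (inj₁ i) = left i
  side (inj₂ j) = right j

∣p++q∣ : ∀ {m n} (p : Subset m) (q : Subset n) → ∣ p ++ q ∣ ≡ ∣ p ∣ + ∣ q ∣
∣p++q∣ []          q = refl
∣p++q∣ (true ∷ p)  q = cong suc (∣p++q∣ p q)
∣p++q∣ (false ∷ p) q = ∣p++q∣ p q

module _ {m n} (p : Subset m) (q : Subset n) where

  ∈-++ˡ⁺ : ∀ {i} → i ∈ p → (i ↑ˡ n) ∈ p ++ q
  ∈-++ˡ⁺ {i} i∈ = lookup⇒[]= (i ↑ˡ n) (p ++ q) (trans (lookup-++ˡ p q i) ([]=⇒lookup i∈))

  ∈-++ˡ⁻ : ∀ {i} → (i ↑ˡ n) ∈ p ++ q → i ∈ p
  ∈-++ˡ⁻ {i} i∈ = lookup⇒[]= i p (trans (sym (lookup-++ˡ p q i)) ([]=⇒lookup i∈))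

  ∈-++ʳ⁺ : ∀ {j} → j ∈ q → (m ↑ʳ j) ∈ p ++ q
  ∈-++ʳ⁺ {j} j∈ = lookup⇒[]= (m ↑ʳ j) (p ++ q) (trans (lookup-++ʳ p q j) ([]=⇒lookup j∈))

  ∈-++ʳ⁻ : ∀ {j} → (m ↑ʳ j) ∈ p ++ q → j ∈ q
  ∈-++ʳ⁻ {j} j∈ = lookup⇒[]= j q (trans (sym (lookup-++ʳ p q j)) ([]=⇒lookup j∈))

full-or-missing : ∀ {n} (p : Subset n) → p ≡ ⊤ ⊎ ∃[ x ] x ∈ ∁ p
full-or-missing []          = inj₁ refl
full-or-missing (false ∷ p) = inj₂ (zero , here)
full-or-missing (true ∷ p) with full-or-missing p
... | inj₁ p≡⊤        = inj₁ (cong (true ∷_) p≡⊤)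
... | inj₂ (x , x∈∁p) = inj₂ (suc x , there x∈∁p)

∣p∣<n⇒missing : ∀ {n} (p : Subset n) → ∣ p ∣ < n → ∃[ x ] x ∈ ∁ p
∣p∣<n⇒missing {n} p ∣p∣<n with full-or-missing p
... | inj₁ refl    = contradiction (∣⊤∣≡n n) (ℕ.<⇒≢ ∣p∣<n)
... | inj₂ missing = missing

missing⇒∣p∣<n : ∀ {n} {p : Subset n} {x} → x ∈ ∁ p → ∣ p ∣ < n
missing⇒∣p∣<n {p = p} x∈∁p = ℕ.≤∧≢⇒< (∣p∣≤n p) λ ∣p∣≡n →
  x∈∁p⇒x∉p x∈∁p (subst (_ ∈_) (sym (∣p∣≡n⇒p≡⊤ ∣p∣≡n)) ∈⊤)

∣p∣≡0⇒∈∁ : ∀ {n} {p : Subset n} → ∣ p ∣ ≡ 0 → ∀ x → x ∈ ∁ p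
∣p∣≡0⇒∈∁ {p = false ∷ p} _      zero    = here
∣p∣≡0⇒∈∁ {p = false ∷ p} ∣p∣≡0 (suc x) = there (∣p∣≡0⇒∈∁ ∣p∣≡0 x)

∁-++ : ∀ {m n} (p : Subset m) (q : Subset n) → ∁ (p ++ q) ≡ ∁ p ++ ∁ q
∁-++ []      q = refl
∁-++ (x ∷ p) q = cong (_ ∷_) (∁-++ p q)

connected⇒edge : ∀ {n} {G : Graph (2 + n)} → Connected G → ∃[ u ] ∃[ v ] Graph._~_ G u v
connected⇒edge connected with connected zero (suc zero) ∈⊤ ∈⊤
... | (_ , _ , u~v) ◅ _ = _ , _ , u~v

module _ (m : ℕ) {n : ℕ} (H : Graph n) where
  private
    J = K̄ m ∨ H
    open Graph J using (_~_)

    l~r : ∀ i j → (i ↑ˡ n) ~ (m ↑ʳ j)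
    l~r i j = subst T (sym (∨-adj-lr (K̄ m) H i j)) _

    r~l : ∀ j i → (m ↑ʳ j) ~ (i ↑ˡ n)
    r~l j i = ~-sym J (l~r i j)

  -- Either both sides survive, or K̄ m is deleted entirely and H is left untouched.
  ∨-connected : Connected H → m < n → ∀ (p : Subset m) (q : Subset n) →
    ∣ p ++ q ∣ ≤ m → ConnectedOn J (∁ (p ++ q))
  ∨-connected connected m<n p q small
    rewrite ∁-++ p q = λ u v u∈ v∈ → walk (sideView m u) (sideView m v) u∈ v∈
    where
    S = ∁ p ++ ∁ q
    lʳ : ∀ {i} → i ∈ ∁ p → (i ↑ˡ n) ∈ S
    lʳ = ∈-++ˡ⁺ (∁ p) (∁ q)
    rʳ : ∀ {j} → j ∈ ∁ q → (m ↑ʳ j) ∈ S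
    rʳ = ∈-++ʳ⁺ (∁ p) (∁ q)
    small′ : ∣ p ∣ + ∣ q ∣ ≤ m
    small′ = subst (_≤ m) (∣p++q∣ p q) small
    walk : ∀ {u v} → SideView m n u → SideView m n v → u ∈ S → v ∈ S →
      Star (λ x y → x ∈ S × y ∈ S × x ~ y) u v
    walk (left i)  (right j) u∈ v∈ = (u∈ , v∈ , l~r i j) ◅ ε
    walk (right j) (left i)  u∈ v∈ = (u∈ , v∈ , r~l j i) ◅ ε
    -- At most m < n deletions leave some vertex on the right, and it is adjacent to both ends.
    walk (left i)  (left i′) u∈ v∈
      with ∣p∣<n⇒missing q (ℕ.≤-<-trans (≤-trans (ℕ.m≤n+m _ _) small′) m<n)
    ... | j , j∈ = (u∈ , rʳ j∈ , l~r i j) ◅ (rʳ j∈ , v∈ , r~l j i′) ◅ ε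
    walk (right j) (right j′) u∈ v∈ with full-or-missing p
    ... | inj₂ (i , i∈) = (u∈ , lʳ i∈ , r~l j i) ◅ (lʳ i∈ , v∈ , l~r i j′) ◅ ε
    ... | inj₁ refl =
      gmap (m ↑ʳ_)
        (λ { {x} {y} (_ , _ , x~y) →
             rʳ (∈∁q x) , rʳ (∈∁q y) , subst T (sym (∨-adj-rr (K̄ m) H x y)) x~y })
        (connected j j′ ∈⊤ ∈⊤)
      where
      ∈∁q : ∀ x → x ∈ ∁ q
      ∈∁q = ∣p∣≡0⇒∈∁ (ℕ.n≤0⇒n≡0 (ℕ.+-cancelˡ-≤ m _ 0
        (subst₂ _≤_ (cong (_+ ∣ q ∣) (∣⊤∣≡n m)) (sym (+-identityʳ m)) small′)))

  ∨-left-independent : Independent J (⊤ {m} ++ ⊥ {n})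
  ∨-left-independent u v = independent (sideView m u) (sideView m v)
    where
    independent : ∀ {u v} → SideView m n u → SideView m n v →
      u ∈ ⊤ {m} ++ ⊥ → v ∈ ⊤ {m} ++ ⊥ → ¬ u ~ v
    independent (left i)  (left i′) _  _  = subst T (∨-adj-ll (K̄ m) H i i′)
    independent (right j) _         u∈ _  = contradiction (∈-++ʳ⁻ (⊤ {m}) ⊥ u∈) ∉⊥
    independent (left _)  (right j) _  v∈ = contradiction (∈-++ʳ⁻ (⊤ {m}) ⊥ v∈) ∉⊥

  ∣∨-left∣ : ∣ ⊤ {m} ++ ⊥ {n} ∣ ≡ m
  ∣∨-left∣ = trans (∣p++q∣ (⊤ {m}) ⊥)
    (trans (cong₂ _+_ (∣⊤∣≡n m) (∣⊥∣≡0 n)) (+-identityʳ m))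

module _ {m : ℕ} (1≤m : 1 ≤ m) {H : Graph (suc m)} (connected : Connected H) where
  private
    J = K̄ m ∨ H

  -- An independent set cannot meet both sides. On the left there are only m vertices; on the right,
  -- `H` is connected with at least two vertices and so has an edge, which rules out taking all m +
  -- 1.
  ∨-independent-≤ : (p : Subset m) (q : Subset (suc m)) → Independent J (p ++ q) → ∣ p ++ q ∣ ≤ m
  ∨-independent-≤ p q indep rewrite ∣p++q∣ p q with nonempty? p | nonempty? q
  ... | yes (i , i∈) | yes (j , j∈) = contradiction (subst T (sym (∨-adj-lr (K̄ m) H i j)) _)
    (indep (i ↑ˡ _) (m ↑ʳ j) (∈-++ˡ⁺ p q i∈) (∈-++ʳ⁺ p q j∈))
  ... | _ | no empty rewrite Empty-unique empty | ∣⊥∣≡0 (suc m) | +-identityʳ ∣ p ∣ = ∣p∣≤n p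
  ... | no empty | _ rewrite Empty-unique empty | ∣⊥∣≡0 m with full-or-missing q
  ... | inj₂ (x , x∈∁q) = s≤s⁻¹ (missing⇒∣p∣<n x∈∁q)
  ... | inj₁ refl = contradiction (edge {H = H} 1≤m connected) noEdge
    where
    edge : ∀ {m} {H : Graph (suc m)} → 1 ≤ m → Connected H → ∃[ u ] ∃[ v ] Graph._~_ H u v
    edge {H = H} (s≤s _) = connected⇒edge {G = H}
    noEdge : ¬ (∃[ u ] ∃[ v ] Graph._~_ H u v)
    noEdge (u , v , u~v) =
      indep (m ↑ʳ u) (m ↑ʳ v) (∈-++ʳ⁺ ⊥ q ∈⊤) (∈-++ʳ⁺ ⊥ q ∈⊤)
        (subst T (sym (∨-adj-rr (K̄ m) H u v)) u~v)

  ∨-inClass : InClass (m + suc m) m (suc m) J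
  ∨-inClass =
    (ℕ.+-monoˡ-≤ (suc m) 1≤m , kconnected) ,
    ((⊤ {m} ++ ⊥ {suc m} , ∨-left-independent m H , ∣∨-left∣ m H) , max)
    where
    kconnected : ∀ S → ∣ S ∣ < suc m → ConnectedOn J (∁ S)
    kconnected S (s≤s small) with Vec.splitAt m S
    ... | p , q , refl = ∨-connected m H connected ≤-refl p q small
    max : ∀ S → Independent J S → ∣ S ∣ ≤ m
    max S indep with Vec.splitAt m S
    ... | p , q , refl = ∨-independent-≤ p q indep

-- Graphs in the class are joins

-- The relabelling that lists `S` and its complement separately; under it a graph of the class takes
-- the form of a join.
enumerate : ∀ {n} (S : Subset n) → Fin n ↔ (Fin ∣ S ∣ ⊎ Fin ∣ ∁ S ∣)
enumerate S = mk↔ₛ′ (to S) (from S) (to∘from S) (from∘to S)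
  where
  to : ∀ {n} (S : Subset n) → Fin n → Fin ∣ S ∣ ⊎ Fin ∣ ∁ S ∣
  to (true ∷ S)  zero    = inj₁ zero
  to (true ∷ S)  (suc x) = Sum.map₁ suc (to S x)
  to (false ∷ S) zero    = inj₂ zero
  to (false ∷ S) (suc x) = Sum.map₂ suc (to S x)
  from : ∀ {n} (S : Subset n) → Fin ∣ S ∣ ⊎ Fin ∣ ∁ S ∣ → Fin n
  from (true ∷ S)  (inj₁ zero)    = zero
  from (true ∷ S)  (inj₁ (suc i)) = suc (from S (inj₁ i))
  from (true ∷ S)  (inj₂ j)       = suc (from S (inj₂ j))
  from (false ∷ S) (inj₁ i)       = suc (from S (inj₁ i))
  from (false ∷ S) (inj₂ zero)    = zero
  from (false ∷ S) (inj₂ (suc j)) = suc (from S (inj₂ j))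
  to∘from : ∀ {n} (S : Subset n) y → to S (from S y) ≡ y
  to∘from (true ∷ S)  (inj₁ zero)    = refl
  to∘from (true ∷ S)  (inj₁ (suc i)) = cong (Sum.map₁ suc) (to∘from S (inj₁ i))
  to∘from (true ∷ S)  (inj₂ j)       = cong (Sum.map₁ suc) (to∘from S (inj₂ j))
  to∘from (false ∷ S) (inj₁ i)       = cong (Sum.map₂ suc) (to∘from S (inj₁ i))
  to∘from (false ∷ S) (inj₂ zero)    = refl
  to∘from (false ∷ S) (inj₂ (suc j)) = cong (Sum.map₂ suc) (to∘from S (inj₂ j))
  from∘to : ∀ {n} (S : Subset n) x → from S (to S x) ≡ x
  from∘to (true ∷ S)  zero    = refl
  from∘to (true ∷ S)  (suc x) with to S x | from∘to S x
  ... | inj₁ _ | eq = cong suc eq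
  ... | inj₂ _ | eq = cong suc eq
  from∘to (false ∷ S) zero    = refl
  from∘to (false ∷ S) (suc x) with to S x | from∘to S x
  ... | inj₁ _ | eq = cong suc eq
  ... | inj₂ _ | eq = cong suc eq

enumerate-inj₁ : ∀ {n} (S : Subset n) i → Inverse.from (enumerate S) (inj₁ i) ∈ S
enumerate-inj₁ (true ∷ S)  zero    = here
enumerate-inj₁ (true ∷ S)  (suc i) = there (enumerate-inj₁ S i)
enumerate-inj₁ (false ∷ S) i       = there (enumerate-inj₁ S i)

enumerate-inj₂ : ∀ {n} (S : Subset n) j → Inverse.from (enumerate S) (inj₂ j) ∈ ∁ S
enumerate-inj₂ (true ∷ S)  j       = there (enumerate-inj₂ S j)
enumerate-inj₂ (false ∷ S) zero    = here
enumerate-inj₂ (false ∷ S) (suc j) = there (enumerate-inj₂ S j)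

x∉p-x : ∀ {n} (p : Subset n) {x} → x ∉ p - x
x∉p-x (_ ∷ p) {zero}  ()
x∉p-x (_ ∷ p) {suc x} (there x∈) = x∉p-x p x∈

-- Otherwise deleting every vertex outside S except v would isolate s from v.
independent-complete : ∀ {n k} {G : Graph n} {S : Subset n} →
  KConnected k G → Independent G S → ∣ ∁ S ∣ ≤ k →
  ∀ {s v} → s ∈ S → v ∈ ∁ S → T (adj G s v)
independent-complete {G = G} {S} (_ , connected) indep ∣∁S∣≤k {s} {v} s∈S v∈∁S
  with connected (∁ S - v) (ℕ.<-≤-trans (x∈p⇒∣p-x∣<∣p∣ v∈∁S) ∣∁S∣≤k) s v
         (x∉p⇒x∈∁p λ s∈ → x∈p⇒x∉∁p s∈S (p─q⊆p (∁ S) _ s∈))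
         (x∉p⇒x∈∁p (x∉p-x (∁ S)))
... | ε = contradiction v∈∁S (x∈p⇒x∉∁p s∈S)
-- The first step of the walk decides: independence keeps `y` out of `S`, and `v` is the only
-- survivor outside `S`.
... | _◅_ {j = y} (_ , y∈ , s~y) _ with y ∈? S | y ≟ v
... | yes y∈S | _        = contradiction s~y (indep s y s∈S y∈S)
... | no _    | yes refl = s~y
... | no y∉S  | no y≢v   =
  contradiction (x∈p∧x≢y⇒x∈p-y (x∉p⇒x∈∁p y∉S) y≢v) (x∈∁p⇒x∉p y∈)

module _ {n} (G : Graph n) (S : Subset n) where
  open Inverse (enumerate S)

  induced-∁ : Graph ∣ ∁ S ∣
  induced-∁ = record
    { adj    = λ i j → adj G (from (inj₂ i)) (from (inj₂ j))
    ; sym    = λ i j → Graph.sym G (from (inj₂ i)) (from (inj₂ j))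
    ; irrefl = λ i → Graph.irrefl G (from (inj₂ i))
    }

  induced-∁-connected : ConnectedOn G (∁ S) → Connected induced-∁
  induced-∁-connected connected i j _ _ =
    transport refl (connected _ _ (enumerate-inj₂ S i) (enumerate-inj₂ S j))
    where
    open Graph G using (_~_)
    -- The start is a variable `u` tied to `i` by an equation, so that the walk can be matched
    -- against `ε`.
    transport : ∀ {i u} → u ≡ from (inj₂ i) →
      Star (λ x y → x ∈ ∁ S × y ∈ ∁ S × x ~ y) u (from (inj₂ j)) →
      Star (λ x y → x ∈ ⊤ × y ∈ ⊤ × Graph._~_ induced-∁ x y) i j
    transport {i} eq ε with trans (sym (strictlyInverseˡ (inj₂ i)))
                                  (trans (cong to (sym eq)) (strictlyInverseˡ (inj₂ j)))
    ... | refl = ε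
    transport {i} refl (_◅_ {j = y} (_ , y∈ , x~y) walk) with to y | strictlyInverseʳ y
    ... | inj₁ s  | refl = contradiction y∈ (x∈p⇒x∉∁p (enumerate-inj₁ S s))
    ... | inj₂ i′ | refl = (∈⊤ , ∈⊤ , x~y) ◅ transport refl walk

  complete⇒≅∨ : Independent G S →
    (∀ {s v} → s ∈ S → v ∈ ∁ S → T (adj G s v)) → G ≅ K̄ ∣ S ∣ ∨ induced-∁
  complete⇒≅∨ indep complete = (↔-sym +↔⊎ ↔-∘ enumerate S) , λ u v →
    trans (adj-join (to u) (to v)) (cong₂ (adj G) (strictlyInverseʳ u) (strictlyInverseʳ v))
    where
    adj-join : ∀ x y →
      adj (K̄ ∣ S ∣ ∨ induced-∁) (join _ _ x) (join _ _ y) ≡ adj G (from x) (from y)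
    adj-join (inj₁ i) (inj₁ j) = trans (∨-adj-ll (K̄ ∣ S ∣) induced-∁ i j)
      (sym (¬T⇒≡false (indep _ _ (enumerate-inj₁ S i) (enumerate-inj₁ S j))))
    adj-join (inj₁ i) (inj₂ j) = trans (∨-adj-lr (K̄ ∣ S ∣) induced-∁ i j)
      (sym (T⇒≡true (complete (enumerate-inj₁ S i) (enumerate-inj₂ S j))))
    adj-join (inj₂ i) (inj₁ j) = trans (∨-adj-rl (K̄ ∣ S ∣) induced-∁ i j)
      (sym (T⇒≡true (~-sym G (complete (enumerate-inj₁ S j) (enumerate-inj₂ S i)))))
    adj-join (inj₂ i) (inj₂ j) = ∨-adj-rr (K̄ ∣ S ∣) induced-∁ i j

inClass⇒≅∨ : ∀ {m} (G : Graph (m + suc m)) → InClass (m + suc m) m (suc m) G →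
  ∃[ H ] Connected {suc m} H × G ≅ K̄ m ∨ H
inClass⇒≅∨ {m} G (kconn , (S , indep , ∣S∣≡m) , _) = resize ∣S∣≡m ∣∁S∣≡1+m
  (induced-∁ G S ,
   induced-∁-connected G S (proj₂ kconn S (ℕ.≤-reflexive (cong suc ∣S∣≡m))) ,
   complete⇒≅∨ G S indep
     (independent-complete {G = G} kconn indep (≤-reflexive ∣∁S∣≡1+m)))
  where
  ∣∁S∣≡1+m : ∣ ∁ S ∣ ≡ suc m
  ∣∁S∣≡1+m = trans (∣∁p∣≡n∸∣p∣ S) (trans (cong (m + suc m ∸_) ∣S∣≡m) (ℕ.m+n∸m≡n m (suc m)))
  -- The two cardinalities become variables here, so that the equations for them can be matched with
  -- `refl`.
  resize : ∀ {a a′ b b′} → a ≡ a′ → b ≡ b′ →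
    ∃[ H ] Connected {b} H × G ≅ K̄ a ∨ H → ∃[ H ] Connected {b′} H × G ≅ K̄ a′ ∨ H
  resize refl refl found = found

-- The extremal function

-- The connected graph with m edges behind the witness for the minimum. Being a join itself, it has
-- its edges counted by `size-∨`.
star : ∀ m → Graph (suc m)
star m = K̄ 1 ∨ K̄ m

star-connected : ∀ {m} → Connected (star m)
star-connected zero    zero    _ _ = ε
star-connected zero    (suc j) _ _ = (∈⊤ , ∈⊤ , _) ◅ ε
star-connected (suc i) zero    _ _ = (∈⊤ , ∈⊤ , _) ◅ ε
star-connected (suc i) (suc j) _ _ = _◅_ {j = zero} (∈⊤ , ∈⊤ , _) ((∈⊤ , ∈⊤ , _) ◅ ε)

size-star : ∀ m → size (star m) ≡ m
size-star m = begin
  size (star m)                   ≡⟨ size-∨ (K̄ 1) (K̄ m) ⟩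
  size (K̄ 1) + 1 * m + size (K̄ m) ≡⟨ cong (size (K̄ 1) + 1 * m +_) (size-K̄ m) ⟩
  1 * m + 0                       ≡⟨ trans (+-identityʳ _) (+-identityʳ m) ⟩
  m                               ∎
  where open ≡-Reasoning

size-K̄∨ : ∀ m {n} (H : Graph n) → size (K̄ m ∨ H) ≡ m * n + size H
size-K̄∨ m {n} H = trans (size-∨ (K̄ m) H) (cong (λ s → s + m * n + size H) (size-K̄ m))

-- Splits k² - 1 into the edges between the two sides of the join and the edges of a tree of order
-- k.
[1+m]²∸1 : ∀ m → suc m ^ 2 ∸ 1 ≡ m * suc m + m
[1+m]²∸1 m = cong (_∸ 1) (expand m)
  where
  expand : ∀ m → suc m * (suc m * 1) ≡ suc (m * suc m + m)
  expand = solve-∀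

module _ {n m} (n≡ : n ≡ m + suc m) (1≤m : 1 ≤ m) where

  -- The order is a variable with an equation, since `2 * suc m ∸ 1` reduces only to
  -- `m + suc (m + 0)`.
  f≡ : f⟨ n , m , suc m ⟩≡ (suc m ^ 2 ∸ 1)
  f≡ rewrite n≡ | [1+m]²∸1 m =
    (K̄ m ∨ star m , ∨-inClass 1≤m {star m} star-connected ,
     trans (size-K̄∨ m (star m)) (cong (m * suc m +_) (size-star m))) ,
    λ G inClass → let H , connected , iso = inClass⇒≅∨ G inClass in begin
      m * suc m + m      ≤⟨ ℕ.+-monoʳ-≤ (m * suc m) (connected⇒size≥ {G = H} connected) ⟩
      m * suc m + size H ≡⟨ size-K̄∨ m H ⟨
      size (K̄ m ∨ H)     ≡⟨ size-≅ {G = G} {K̄ m ∨ H} iso ⟨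
      size G             ∎
    where open ℕ.≤-Reasoning

  -- Once the m(m + 1) edges of the join are cancelled, both directions become the criterion that a
  -- connected graph of order m + 1 is acyclic exactly when it has m edges.
  extremal⇔ : ∀ (G : Graph n) →
    Extremal n m (suc m) G ⇔ (∃[ H ] IsTree {suc m} H × G ≅ K̄ m ∨ H)
  extremal⇔ G = mk⇔ (only n≡) if
    where
    size-≅-∨ : ∀ {H : Graph (suc m)} → G ≅ K̄ m ∨ H → size G ≡ m * suc m + size H
    size-≅-∨ {H} iso = trans (size-≅ {G = G} {K̄ m ∨ H} iso) (size-K̄∨ m H)

    decompose : ∀ {n} → n ≡ m + suc m → (G : Graph n) → InClass n m (suc m) G →
      ∃[ H ] Connected {suc m} H × G ≅ K̄ m ∨ H
    decompose refl = inClass⇒≅∨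

    only : n ≡ m + suc m → Extremal n m (suc m) G → ∃[ H ] IsTree {suc m} H × G ≅ K̄ m ∨ H
    only n≡ (inClass , (_ , minimal)) with decompose n≡ G inClass | f≡
    ... | H , connected , iso | (G₀ , inClass₀ , size₀) , _ =
      H , (connected , size≡⇒acyclic {G = H} connected
             (≤-antisym sizeH≤ (connected⇒size≥ {G = H} connected))) , iso
      where
      open ℕ.≤-Reasoning
      sizeH≤ : size H ≤ m
      sizeH≤ = ℕ.+-cancelˡ-≤ (m * suc m) _ _ (begin
        m * suc m + size H ≡⟨ size-≅-∨ {H} iso ⟨
        size G             ≤⟨ minimal G₀ inClass₀ ⟩
        size G₀            ≡⟨ size₀ ⟩
        suc m ^ 2 ∸ 1      ≡⟨ [1+m]²∸1 m ⟩
        m * suc m + m      ∎)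

    if : ∃[ H ] IsTree {suc m} H × G ≅ K̄ m ∨ H → Extremal n m (suc m) G
    if (H , (connected , acyclic) , iso) =
      InClass-≅ {G = G} {K̄ m ∨ H} iso (∨-inClass 1≤m {H} connected) ,
      subst (f⟨ n , m , suc m ⟩≡_) (sym sizeG) f≡
      where
      sizeG : size G ≡ suc m ^ 2 ∸ 1
      sizeG = trans (size-≅-∨ {H} iso)
        (trans (cong (m * suc m +_) (acyclic⇒size≡ {G = H} connected acyclic)) (sym ([1+m]²∸1 m)))

-- For n = 2k - 1 and α = k - 1 the conjectured value is k² - ⌊k/2⌋, which equals k² - 1 at k = 3
-- and first falls below it at k = 4.
bougardJoret-false : ¬ BougardJoretConjecture
bougardJoret-false conjecture =
  contradiction (subst (15 ≤_) size≡14 (proj₂ f≡15 G inClass)) (ℕ.<⇒≱ ≤-refl)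
  where
  f≡15 : f⟨ 7 , 3 , 4 ⟩≡ 15
  f≡15 = f≡ {7} {3} refl (s≤s z≤n)
  f≡14 : f⟨ 7 , 3 , 4 ⟩≡ 14
  -- The branch n ≤ kα applies, as 7 ≤ 12, and ⌈7 · 4 / 2⌉ computes to 14.
  f≡14 = proj₁ (conjecture 7 3 4 (ℕ.m≤m+n 6 1) ≤-refl (ℕ.m≤m+n 2 1) (ℕ.m≤m+n 3 1)) (ℕ.m≤m+n 7 5)
  G = proj₁ (proj₁ f≡14)
  inClass = proj₁ (proj₂ (proj₁ f≡14))
  size≡14 = proj₂ (proj₂ (proj₁ f≡14))

corollary3p3 : (∀ (k : ℕ) → k ≥ 4 →
    (f⟨ 2 * k ∸ 1 , k ∸ 1 , k ⟩≡ (k ^ 2 ∸ 1)) ×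
    (∀ (G : Graph (2 * k ∸ 1)) →
    Extremal (2 * k ∸ 1) (k ∸ 1) k G ⇔
    (∃[ H ] IsTree {k} H × G ≅ (K̄ (k ∸ 1) ∨ H)))) ×
    ¬ BougardJoretConjecture
corollary3p3 = forAllK , bougardJoret-false
  where
  forAllK : ∀ k → k ≥ 4 → _
  forAllK (suc m) (s≤s 3≤m) = f≡ order 1≤m , extremal⇔ order 1≤m
    where
    order : 2 * suc m ∸ 1 ≡ m + suc m
    order = cong (λ x → m + suc x) (+-identityʳ m)
    1≤m : 1 ≤ m
    1≤m = ≤-trans (s≤s z≤n) 3≤m
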